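{- Let $n\ge1$ and let $K$ be a connected pure $n$-simplicial complex. Then $K$ is a simplicial tree if and only if all of the following hold: (1) between any two distinct $(n-1)$-simplices of $K$ there exists a unique reduced $(n-1,n)$-path sequence; (2) if $n\ge 2$, then for every $0\le m\le n-2$ and any two distinct $m$-simplices $\sigma_i,\sigma_j$ of $K$ that are not both faces of a common joint $(n-1)$-simplex, there exists a unique reduced simplicial path between $\sigma_i$ and $\sigma_j$; (3) if $n\ge2$, then for every $0\le m\le n-2$, $K$ contains no $(m,n)$-simplicial cycle sequence.
   Context: A simplicial complex $K$ on a finite vertex set is a collection of non-empty vertex subsets containing all singletons and closed under taking non-empty subsets; a $k$-simplex has $k+1$ vertices, and $\tau$ is a face of $\sigma$ if $\tau\subseteq\sigma$. $K$ is a pure $n$-simplicial complex if $\dim K=n$ and every simplex is a face of some $n$-simplex of $K$. For a set $S$ of simplices, $\overline{S}$ is the set of all faces of members of $S$. Let $0\le m\le n-1$. An $(m,n)$-walk sequence between $m$-simplices $\sigma,\sigma'$ is an alternating sequence $\sigma=\sigma_1,\eta_1,\sigma_2,\dots,\sigma_r,\eta_r,\sigma_{r+1}=\sigma'$ of $m$-simplices $\sigma_k$ and $n$-simplices $\eta_k$ of $K$ with $\sigma_k\ne\sigma_{k+1}$ and both faces of $\eta_k$ ($1\le k\le r$). It is an $(m,n)$-path sequence if all its simplices are distinct. $K$ is connected if there is an $(n-1,n)$-path sequence between every pair of distinct $(n-1)$-simplices. An $(m,n)$-path sequence $\sigma_1,\eta_1,\dots,\sigma_r,\eta_r,\sigma_{r+1}$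 is reduced if (i) among $\eta_1,\dots,\eta_r$, $\sigma_1$ is a face only of $\eta_1$ and $\sigma_{r+1}$ is a face only of $\eta_r$; (ii) for each $2\le z\le r$ there is an $(n-1)$-simplex $\sigma'_z$ of $K$ which is a face of both $\eta_{z-1}$ and $\eta_z$ and has $\sigma_z$ as a face, with $\sigma'_x\ne\sigma'_y$ for $2\le x\neq y\le r$. The subcomplex $\overline{\{\eta_1,\dots,\eta_r\}}$ is the reduced simplicial path of this sequence; a reduced simplicial path between $\sigma_i,\sigma_j$ means the reduced simplicial path of some reduced $(m,n)$-path sequence between them. An $(m,n)$-circuit sequence is an $(m,n)$-walk sequence with $\sigma_{r+1}=\sigma_1$ and $\sigma_p\ne\sigma_q$, $\eta_p\ne\eta_q$ for $1\le p\ne q\le r$; it is an $(m,n)$-simplicial cycle sequence if moreover $r\ge 3$, $\sigma_1$ is not a face of $\eta_k$ for $2\le k\le r-1$, and condition (ii) above holds (for each $2\le z\le r$ an $(n-1)$-simplex $\sigma'_z$ face of $\eta_{z-1}$ and $\eta_z$ containing $\sigma_z$, pairwise distinct). $K$ is acyclic if it has no $(m,n)$-simplicial cycle sequence for any $0\le m\le n-1$; a simplicial tree is a connected acyclic pure $n$-simplicial complex. A simplex is joint if it is a face of at least two distinct $n$-simplices of $K$. -}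

module Defs where

open import Data.Nat using (ℕ; zero; suc; _≤_; _<_; _∸_; _+_)
open import Data.Fin using (Fin)
open import Data.Fin.Subset using (Subset; _⊆_; ∣_∣; ⁅_⁆; Nonempty)
open import Data.Bool using (Bool; T)
open import Data.Product using (Σ; ∃; ∃-syntax; _×_; _,_)
open import Relation.Binary.PropositionalEquality using (_≡_; _≢_)
open import Relation.Nullary using (¬_)
open import Function.Bundles using (_⇔_)

record Complex (V : ℕ) : Set where
  field
    mem        : Subset V → Bool
    nonempty   : ∀ s → T (mem s) → Nonempty s
    singletons : ∀ v → T (mem ⁅ v ⁆)
    closed     : ∀ s t → T (mem s) → Nonempty t → t ⊆ s → T (mem t)
open Complex public

module _ {V : ℕ} (K : Complex V) where

  IsSimplex : ℕ → Subset V → Set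
  IsSimplex k s = T (mem K s) × ∣ s ∣ ≡ suc k

  HasDim : ℕ → Set
  HasDim n = (∃[ s ] IsSimplex n s) × (∀ s → T (mem K s) → ∣ s ∣ ≤ suc n)

  Pure : ℕ → Set
  Pure n = HasDim n × (∀ s → T (mem K s) → ∃[ e ] (IsSimplex n e × s ⊆ e))

  -- A sequence sigma_0, eta_0, sigma_1, ..., eta_{r-1}, sigma_r
  -- (0-based indexing; only indices ≤ r for sig and < r for eta matter).
  record Seq : Set where
    constructor mkSeq
    field
      len : ℕ
      sig : ℕ → Subset V
      eta : ℕ → Subset V
  open Seq public

  IsWalk : ℕ → ℕ → Subset V → Subset V → Seq → Set
  IsWalk m n a b p =
    sig p 0 ≡ a × sig p (len p) ≡ b ×
    (∀ k → k ≤ len p → IsSimplex m (sig p k)) ×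
    (∀ k → k < len p →
       IsSimplex n (eta p k) × sig p k ≢ sig p (suc k) ×
       sig p k ⊆ eta p k × sig p (suc k) ⊆ eta p k)

  IsPath : ℕ → ℕ → Subset V → Subset V → Seq → Set
  IsPath m n a b p =
    IsWalk m n a b p ×
    (∀ i j → i ≤ len p → j ≤ len p → sig p i ≡ sig p j → i ≡ j) ×
    (∀ i j → i < len p → j < len p → eta p i ≡ eta p j → i ≡ j)

  -- condition (ii): for each 1-based 2 ≤ z ≤ r (0-based z = suc w with suc w < r)
  -- an (n-1)-simplex sp z, face of eta_{z-1} and eta_z, containing sig z,
  -- pairwise distinct.
  CondII : ℕ → Seq → Set
  CondII n p =
    Σ (ℕ → Subset V) λ sp → ((∀ w → suc w < len p →
               IsSimplex (n ∸ 1) (sp (suc w)) ×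
               sp (suc w) ⊆ eta p w × sp (suc w) ⊆ eta p (suc w) ×
               sig p (suc w) ⊆ sp (suc w)) ×
             (∀ x y → suc x < len p → suc y < len p →
               sp (suc x) ≡ sp (suc y) → x ≡ y))

  IsReduced : ℕ → ℕ → Subset V → Subset V → Seq → Set
  IsReduced m n a b p =
    IsPath m n a b p ×
    (∀ k → k < len p → sig p 0 ⊆ eta p k → k ≡ 0) ×
    (∀ k → k < len p → sig p (len p) ⊆ eta p k → suc k ≡ len p) ×
    CondII n p

  SameSeq : Seq → Seq → Set
  SameSeq p q = len p ≡ len q ×
    (∀ k → k ≤ len p → sig p k ≡ sig q k) ×
    (∀ k → k < len p → eta p k ≡ eta q k)

  InPathComplex : Seq → Subset V → Set
  InPathComplex p t = Nonempty t × ∃[ k ] (k < len p × t ⊆ eta p k)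

  -- two sequences have the same reduced simplicial path
  SamePathComplex : Seq → Seq → Set
  SamePathComplex p q = ∀ t → InPathComplex p t ⇔ InPathComplex q t

  IsCircuit : ℕ → ℕ → Seq → Set
  IsCircuit m n p =
    IsWalk m n (sig p 0) (sig p 0) p ×
    (∀ i j → i < len p → j < len p → i ≢ j →
       sig p i ≢ sig p j × eta p i ≢ eta p j)

  IsSimplicialCycle : ℕ → ℕ → Seq → Set
  IsSimplicialCycle m n p =
    IsCircuit m n p × 3 ≤ len p ×
    (∀ k → 1 ≤ k → suc k < len p → ¬ (sig p 0 ⊆ eta p k)) ×
    CondII n p

  Connected : ℕ → Set
  Connected n = ∀ a b → IsSimplex (n ∸ 1) a → IsSimplex (n ∸ 1) b → a ≢ b →
    ∃[ p ] IsPath (n ∸ 1) n a b p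

  Acyclic : ℕ → Set
  Acyclic n = ∀ m p → m < n → ¬ IsSimplicialCycle m n p

  SimplicialTree : ℕ → Set
  SimplicialTree n = Connected n × Acyclic n × Pure n

  Joint : ℕ → Subset V → Set
  Joint n s = ∃[ e₁ ] ∃[ e₂ ] (IsSimplex n e₁ × IsSimplex n e₂ × e₁ ≢ e₂ ×
                               s ⊆ e₁ × s ⊆ e₂)

  Cond1 : ℕ → Set
  Cond1 n = ∀ a b → IsSimplex (n ∸ 1) a → IsSimplex (n ∸ 1) b → a ≢ b →
    (∃[ p ] IsReduced (n ∸ 1) n a b p) ×
    (∀ p q → IsReduced (n ∸ 1) n a b p → IsReduced (n ∸ 1) n a b q → SameSeq p q)

  -- vacuous when n = 1 (no m with m + 2 ≤ n)
  Cond2 : ℕ → Set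
  Cond2 n = ∀ m a b → m + 2 ≤ n → IsSimplex m a → IsSimplex m b → a ≢ b →
    ¬ (∃[ τ ] (IsSimplex (n ∸ 1) τ × Joint n τ × a ⊆ τ × b ⊆ τ)) →
    (∃[ p ] IsReduced m n a b p) ×
    (∀ p q → IsReduced m n a b p → IsReduced m n a b q → SamePathComplex p q)

  Cond3 : ℕ → Set
  Cond3 n = ∀ m p → m + 2 ≤ n → ¬ IsSimplicialCycle m n p

{-# OPTIONS --safe #-}
-- Everything in the forward direction follows from acyclicity for m = 0. Call a sequence of
-- n-simplices, consecutive ones meeting in (n-1)-simplices, non-backtracking if it never leaves
-- an n-simplex through the (n-1)-simplex by which it entered. Along such a walk the members
-- containing a given vertex v are consecutive: in a shortest counterexample v lies only in the
-- first and the last member, and the vertices newly entered at each step are distinct, so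
-- together with v they form a (0,n)-simplicial cycle sequence. Hence a non-backtracking walk is
-- never closed and is determined by its ends, and the n-simplices containing a fixed simplex
-- behave like a subtree; uniqueness in (1) and (2) follows by gluing two walks at the point
-- where they separate. The newly entered vertices also provide the distinct m-simplices needed
-- for existence in (2). Conversely, an (n-1,n)-cycle contains two different reduced paths
-- between its first two (n-1)-simplices.
module Submission where

open import Defs
open import Data.Nat
  using (ℕ; zero; suc; _+_; _∸_; _≤_; _<_; z≤n; s≤s; s≤s⁻¹; z<s; s<s; s<s⁻¹)
open import Data.Nat.Properties
  using (≤-refl; ≤-trans; ≤-reflexive; ≤-antisym; <-trans; <-≤-trans; ≤-<-trans; <-irrefl;
         <⇒≤; <-cmp; n≤1+n; n<1+n; 1+n≢0; 1+n≢n; m≤m+n;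
         suc-injective; +-suc; +-comm; +-identityʳ; +-monoˡ-<; +-monoˡ-≤; <⇒≢;
         m≤n⇒m<n∨m≡n; m∸n+n≡m; n<1⇒n≡0)
open import Data.Nat.Induction using (<-rec)
open import Data.Bool.Properties using () renaming (_≟_ to _≟ᵇ_)
open import Data.Fin.Properties using (¬∀⟶∃¬) renaming (_≟_ to _≟ᶠ_)
open import Data.Fin.Subset
open import Data.Fin.Subset.Properties
open import Data.Product using (Σ; ∃; ∃-syntax; _×_; _,_; proj₁; proj₂)
open import Data.Sum using (_⊎_; inj₁; inj₂)
open import Data.Vec using ([]; _∷_; here)
open import Data.Vec.Properties using (≡-dec)
open import Function using (_∘_; _∋_; id)
open import Function.Bundles using (_⇔_; mk⇔)
open import Relation.Binary using (tri<; tri≈; tri>)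
open import Relation.Binary.PropositionalEquality
  using (_≡_; _≢_; refl; sym; trans; cong; subst; ≢-sym)
open import Relation.Nullary using (¬_; Dec; yes; no; contradiction)
open import Relation.Nullary.Decidable using (_→-dec_; decidable-stable)

private variable
  V : ℕ
  p q : Subset V

-- Subsets of the vertex set.

_≟ˢ_ : (p q : Subset V) → Dec (p ≡ q)
_≟ˢ_ = ≡-dec _≟ᵇ_

⊈⇒∃ : ¬ p ⊆ q → ∃[ v ] (v ∈ p × v ∉ q)
⊈⇒∃ {p = p} {q} p⊈q
  with v , ¬imp ← ¬∀⟶∃¬ _ (λ v → v ∈ p → v ∈ q) (λ v → (v ∈? p) →-dec (v ∈? q))
                    (λ h → p⊈q λ {v} → h v)
  = v , decidable-stable (v ∈? p) (λ v∉p → ¬imp λ v∈p → contradiction v∈p v∉p) ,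
    λ v∈q → ¬imp λ _ → v∈q

⊆∧∣∣≡⇒⊇ : p ⊆ q → ∣ p ∣ ≡ ∣ q ∣ → q ⊆ p
⊆∧∣∣≡⇒⊇ {p = p} {q} p⊆q eq with q ⊆? p
... | yes q⊆p = q⊆p
... | no q⊈p = contradiction (p⊂q⇒∣p∣<∣q∣ (p⊆q , ⊈⇒∃ q⊈p)) (<-irrefl eq)

⊆∧∣∣≡⇒≡ : p ⊆ q → ∣ p ∣ ≡ ∣ q ∣ → p ≡ q
⊆∧∣∣≡⇒≡ p⊆q eq = ⊆-antisym p⊆q (⊆∧∣∣≡⇒⊇ p⊆q eq)

-- Elements of `q` outside `p` are discarded while more than `c` elements are left.
⊆-interpolate : (p q : Subset V) (c : ℕ) → p ⊆ q → ∣ p ∣ ≤ c → c ≤ ∣ q ∣ →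
  ∃[ r ] (p ⊆ r × r ⊆ q × ∣ r ∣ ≡ c)
⊆-interpolate [] [] zero p⊆q _ _ = [] , id , id , refl
⊆-interpolate (inside ∷ p) (outside ∷ q) c p⊆q _ _ with () ← p⊆q here
⊆-interpolate (inside ∷ p) (inside ∷ q) (suc c) p⊆q p≤c c≤q
  with r , p⊆r , r⊆q , eq ← ⊆-interpolate p q c (drop-∷-⊆ p⊆q) (s≤s⁻¹ p≤c) (s≤s⁻¹ c≤q)
  = inside ∷ r , in⊆in p⊆r , in⊆in r⊆q , cong suc eq
⊆-interpolate (outside ∷ p) (outside ∷ q) c p⊆q p≤c c≤q
  with r , p⊆r , r⊆q , eq ← ⊆-interpolate p q c (drop-∷-⊆ p⊆q) p≤c c≤q
  = outside ∷ r , out⊆ p⊆r , out⊆ r⊆q , eq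
⊆-interpolate (outside ∷ p) (inside ∷ q) c p⊆q p≤c c≤q with m≤n⇒m<n∨m≡n c≤q
... | inj₂ eq = inside ∷ q , p⊆q , id , sym eq
... | inj₁ c<q
  with r , p⊆r , r⊆q , eq ← ⊆-interpolate p q c (drop-∷-⊆ p⊆q) p≤c (s≤s⁻¹ c<q)
  = outside ∷ r , out⊆ p⊆r , out⊆ r⊆q , eq

∣∣≡suc⇒Nonempty : ∀ {k} → ∣ p ∣ ≡ suc k → Nonempty p
∣∣≡suc⇒Nonempty {V} {p} eq with nonempty? p
... | yes ne = ne
... | no ¬ne = contradiction
  (trans (sym eq) (trans (cong ∣_∣ (Empty-unique ¬ne)) (∣⊥∣≡0 V))) 1+n≢0

x∈p⇒⁅x⁆⊆p : ∀ {x} → x ∈ p → ⁅ x ⁆ ⊆ p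
x∈p⇒⁅x⁆⊆p x∈p y∈ = subst (_∈ _) (sym (x∈⁅y⁆⇒x≡y _ y∈)) x∈p

-- Choosing and gluing sequences.

-- Prescribing the value at `g` lets the end simplex of a path follow the chosen ones.
finiteChoice : ∀ {A : Set} {P : ℕ → A → Set} (z : A) g → (∀ k → k < g → ∃ (P k)) →
  Σ (ℕ → A) λ f → f g ≡ z × (∀ k → k < g → P k (f k))
finiteChoice z zero _ = (λ _ → z) , refl , λ _ ()
finiteChoice {A} {P} z (suc g) h
  with f , fg≡z , Pf ← finiteChoice {P = P ∘ suc} z g (λ k k<g → h (suc k) (s<s k<g))
  = f⁺ , fg≡z , Pf⁺
  where
  f⁺ : ℕ → A
  f⁺ zero = proj₁ (h 0 z<s)
  f⁺ (suc k) = f k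
  Pf⁺ : ∀ k → k < suc g → P k (f⁺ k)
  Pf⁺ zero _ = proj₂ (h 0 z<s)
  Pf⁺ (suc k) k<g = Pf k (s<s⁻¹ k<g)

<-distinct⇒injective : ∀ {A : Set} {f : ℕ → A} {r} →
  (∀ {i j} → i < j → j < r → f i ≢ f j) → ∀ i j → i < r → j < r → f i ≡ f j → i ≡ j
<-distinct⇒injective distinct i j i<r j<r eq with <-cmp i j
... | tri< i<j _ _ = contradiction eq (distinct i<j j<r)
... | tri≈ _ i≡j _ = i≡j
... | tri> _ _ j<i = contradiction (sym eq) (distinct j<i i<r)

infixr 5 _◁_
_◁_ : ∀ {A : Set} → A → (ℕ → A) → ℕ → A
(x ◁ E) zero = x
(x ◁ E) (suc k) = E k

tail : ∀ {A : Set} → (ℕ → A) → ℕ → A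
tail E k = E (suc k)

-- The sequence E r, …, E 1, F 0, F 1, …; E 0 is dropped, being meant to equal F 0.
glue : ∀ {A : Set} → ℕ → (ℕ → A) → (ℕ → A) → ℕ → A
glue zero E F = F
glue (suc r) E F = glue r (tail E) (E 1 ◁ F)

glue-first : ∀ {A : Set} r (E F : ℕ → A) → E 0 ≡ F 0 → glue r E F 0 ≡ E r
glue-first zero E F eq = sym eq
glue-first (suc r) E F eq = glue-first r (tail E) (E 1 ◁ F) refl

glue-last : ∀ {A : Set} r (E F : ℕ → A) k → glue r E F (r + k) ≡ F k
glue-last zero E F k = refl
glue-last (suc r) E F k =
  trans (cong (glue r (tail E) (E 1 ◁ F)) (sym (+-suc r k))) (glue-last r (tail E) (E 1 ◁ F) (suc k))

module Walks {V : ℕ} (N : ℕ) (K : Complex V) where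

  private variable
    X Y Z z z' a b : Subset V
    E F : ℕ → Subset V
    g h i j k r s : ℕ

  -- Facets, ridges and adjacency.

  face-of : ∀ {m} → IsSimplex K m X → Y ⊆ X → ∣ Y ∣ ≡ suc k → IsSimplex K k Y
  face-of (memX , _) Y⊆X eq = closed K _ _ memX (∣∣≡suc⇒Nonempty eq) Y⊆X , eq

  simplex-≡ : ∀ {m} → IsSimplex K m X → IsSimplex K m Y → X ⊆ Y → X ≡ Y
  simplex-≡ (_ , eqX) (_ , eqY) X⊆Y = ⊆∧∣∣≡⇒≡ X⊆Y (trans eqX (sym eqY))

  vertex-simplex : ∀ v → IsSimplex K 0 ⁅ v ⁆
  vertex-simplex v = singletons K v , ∣⁅x⁆∣≡1 v

  Facet : Subset V → Set
  Facet = IsSimplex K (suc N)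

  Ridge : Subset V → Set
  Ridge = IsSimplex K N

  Adj : Subset V → Subset V → Set
  Adj X Y = Facet X × Facet Y × X ≢ Y × Ridge (X ∩ Y)

  -- The walk X, Y, Z does not leave Y through the ridge by which it entered.
  Turn : Subset V → Subset V → Subset V → Set
  Turn X Y Z = ∃[ w ] (w ∈ Y × w ∉ X × w ∈ Z)

  ∩-greatest : z ⊆ X → z ⊆ Y → z ⊆ X ∩ Y
  ∩-greatest z⊆X z⊆Y v∈z = x∈p∩q⁺ (z⊆X v∈z , z⊆Y v∈z)

  Adj-sym : Adj X Y → Adj Y X
  Adj-sym {X} {Y} (fX , fY , X≢Y , ridge) = fY , fX , ≢-sym X≢Y , subst Ridge (∩-comm X Y) ridge

  -- `X ∩ Y` is a proper subset of `X`, so it has at most `suc N` elements, the size of its subset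
  -- `z`.
  ridge⇒≡∩ : Facet X → Facet Y → X ≢ Y → Ridge z → z ⊆ X → z ⊆ Y → z ≡ X ∩ Y
  ridge⇒≡∩ {X} {Y} {z} fX fY X≢Y (_ , ∣z∣) z⊆X z⊆Y =
    ⊆∧∣∣≡⇒≡ z⊆X∩Y (≤-antisym (p⊆q⇒∣p∣≤∣q∣ z⊆X∩Y) ∣X∩Y∣≤)
    where
    z⊆X∩Y : z ⊆ X ∩ Y
    z⊆X∩Y = ∩-greatest z⊆X z⊆Y
    X∩Y⊂X : X ∩ Y ⊂ X
    X∩Y⊂X = p∩q⊆p X Y , ⊈⇒∃ λ X⊆X∩Y → X≢Y (simplex-≡ fX fY (⊆-trans X⊆X∩Y (p∩q⊆q X Y)))
    ∣X∩Y∣≤ : ∣ X ∩ Y ∣ ≤ ∣ z ∣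
    ∣X∩Y∣≤ = subst (∣ X ∩ Y ∣ ≤_) (sym ∣z∣)
      (s≤s⁻¹ (subst (∣ X ∩ Y ∣ <_) (proj₂ fX) (p⊂q⇒∣p∣<∣q∣ X∩Y⊂X)))

  ridge⇒Adj : Facet X → Facet Y → X ≢ Y → Ridge z → z ⊆ X → z ⊆ Y → Adj X Y
  ridge⇒Adj fX fY X≢Y rz z⊆X z⊆Y =
    fX , fY , X≢Y , subst Ridge (ridge⇒≡∩ fX fY X≢Y rz z⊆X z⊆Y) rz

  ridge-unique : Facet X → Facet Y → X ≢ Y → Ridge z → z ⊆ X → z ⊆ Y →
    Ridge z' → z' ⊆ X → z' ⊆ Y → z ≡ z'
  ridge-unique fX fY X≢Y rz z⊆X z⊆Y rz' z'⊆X z'⊆Y =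
    trans (ridge⇒≡∩ fX fY X≢Y rz z⊆X z⊆Y) (sym (ridge⇒≡∩ fX fY X≢Y rz' z'⊆X z'⊆Y))

  Adj-new : Adj X Y → ∃[ w ] (w ∈ Y × w ∉ X)
  Adj-new (fX , fY , X≢Y , _) = ⊈⇒∃ λ Y⊆X → X≢Y (sym (simplex-≡ fY fX Y⊆X))

  -- If `v ≢ w`, then `X ∩ Y ⊂ Y - w ⊂ Y`, although the sizes of the outer sets differ by one.
  Adj-new-unique : ∀ {v w} → Adj X Y → v ∈ Y → v ∉ X → w ∈ Y → w ∉ X → v ≡ w
  Adj-new-unique {X} {Y} {v} {w} (_ , (_ , ∣Y∣) , _ , (_ , ∣X∩Y∣)) v∈Y v∉X w∈Y w∉X
    with v ≟ᶠ w
  ... | yes v≡w = v≡w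
  ... | no v≢w = contradiction
    (≤-<-trans (subst (_< ∣ Y - w ∣) ∣X∩Y∣ (p⊂q⇒∣p∣<∣q∣ X∩Y⊂Y-w))
               (subst (∣ Y - w ∣ <_) ∣Y∣ (x∈p⇒∣p-x∣<∣p∣ w∈Y)))
    (<-irrefl refl)
    where
    X∩Y⊂Y-w : X ∩ Y ⊂ Y - w
    X∩Y⊂Y-w =
      (λ u∈ → let u∈X , u∈Y = x∈p∩q⁻ X Y u∈ in
         x∈p∧x≢y⇒x∈p-y u∈Y λ u≡w → w∉X (subst (_∈ X) u≡w u∈X)) ,
      v , x∈p∧x≢y⇒x∈p-y v∈Y v≢w , v∉X ∘ p∩q⊆p X Y

  -- `Y` has exactly one vertex outside `X` and one outside `Z`; a turn says that these two differ.
  Turn-sym : Adj X Y → Adj Y Z → Turn X Y Z → Turn Z Y X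
  Turn-sym {X} XY YZ (w , w∈Y , w∉X , w∈Z) with Adj-new (Adj-sym YZ)
  ... | u , u∈Y , u∉Z with u ∈? X
  ...   | yes u∈X = u , u∈Y , u∉Z , u∈X
  ...   | no u∉X = contradiction (subst (_∈ _) (Adj-new-unique XY w∈Y w∉X u∈Y u∉X) w∈Z) u∉Z

  -- The ridges `X ∩ Y` and `Y ∩ Z` have equal size, so they coincide as soon as one contains the
  -- other; the second alternative records this.
  Turn? : Adj X Y → Adj Y Z → Turn X Y Z ⊎ (X ∩ Y ⊆ Z × Y ∩ Z ⊆ X)
  Turn? {X} {Y} {Z} (_ , _ , _ , (_ , ∣X∩Y∣)) (_ , _ , _ , (_ , ∣Y∩Z∣)) with (Y ∩ Z) ⊆? X
  ... | no ⊈ with w , w∈ , w∉X ← ⊈⇒∃ ⊈ =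
    inj₁ (w , p∩q⊆p Y Z w∈ , w∉X , p∩q⊆q Y Z w∈)
  ... | yes ⊆X = inj₂ ((λ v∈ → p∩q⊆q Y Z (X∩Y⊆Y∩Z v∈)) , ⊆X)
    where
    X∩Y⊆Y∩Z : X ∩ Y ⊆ Y ∩ Z
    X∩Y⊆Y∩Z = ⊆∧∣∣≡⇒⊇ (∩-greatest ⊆X (p∩q⊆p Y Z)) (trans ∣Y∩Z∣ (sym ∣X∩Y∣))

  -- Non-backtracking walks

  record NonBacktracking (E : ℕ → Subset V) (g : ℕ) : Set where
    constructor nb
    field
      facets : ∀ k → k ≤ g → Facet (E k)
      adj    : ∀ k → k < g → Adj (E k) (E (suc k))
      turn   : ∀ k → suc k < g → Turn (E k) (E (suc k)) (E (2 + k))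
  open NonBacktracking

  nb-tail : NonBacktracking E (suc g) → NonBacktracking (tail E) g
  nb-tail W = nb (λ k k≤g → facets W (suc k) (s≤s k≤g)) (λ k k<g → adj W (suc k) (s<s k<g))
                 (λ k k<g → turn W (suc k) (s<s k<g))

  nb-init : h ≤ g → NonBacktracking E g → NonBacktracking E h
  nb-init h≤g W = nb (λ k k≤h → facets W k (≤-trans k≤h h≤g)) (λ k k<h → adj W k (<-≤-trans k<h h≤g))
                     (λ k k<h → turn W k (<-≤-trans k<h h≤g))

  nb-const : Facet X → NonBacktracking (λ _ → X) 0
  nb-const fX = nb (λ _ _ → fX) (λ _ ()) (λ _ ())

  nb-cons : Adj X (E 0) → (0 < g → Turn X (E 0) (E 1)) →
    NonBacktracking E g → NonBacktracking (X ◁ E) (suc g)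
  nb-cons {X} {E} {g} XE t W = nb fs as ts
    where
    fs : ∀ k → k ≤ suc g → Facet ((X ◁ E) k)
    fs zero _ = proj₁ XE
    fs (suc k) k≤g = facets W k (s≤s⁻¹ k≤g)
    as : ∀ k → k < suc g → Adj ((X ◁ E) k) (E k)
    as zero _ = XE
    as (suc k) k<g = adj W k (s<s⁻¹ k<g)
    ts : ∀ k → suc k < suc g → Turn ((X ◁ E) k) (E k) (E (suc k))
    ts zero 0<g = t (s<s⁻¹ 0<g)
    ts (suc k) k<g = turn W k (s<s⁻¹ k<g)

  -- Facets of `E` move in front of `F` one by one, so `E` is run backwards and its turns are
  -- reversed; only the turn at the junction is new.
  nb-glue : ∀ r {s E F} → NonBacktracking E r → NonBacktracking F s → E 0 ≡ F 0 →
    (0 < r → 0 < s → Turn (E 1) (E 0) (F 1)) → NonBacktracking (glue r E F) (r + s)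
  nb-glue zero WE WF _ _ = WF
  nb-glue (suc r) {s} {E} {F} WE WF E₀≡F₀ t =
    subst (NonBacktracking (glue r (tail E) (E 1 ◁ F))) (+-suc r s)
      (nb-glue r (nb-tail WE)
        (nb-cons (subst (Adj (E 1)) E₀≡F₀ (Adj-sym (adj WE 0 z<s)))
                 (λ 0<s → subst (λ x → Turn (E 1) x (F 1)) E₀≡F₀ (t z<s 0<s)) WF)
        refl
        (λ 0<r _ → subst (Turn (E 2) (E 1)) E₀≡F₀
          (Turn-sym (adj WE 0 z<s) (adj WE 1 (s<s 0<r)) (turn WE 0 (s<s 0<r)))))

  -- Convexity of stars along walks.

  -- Fixing the length allows a strong induction that uses convexity of shorter walks.
  Convex : ℕ → Set
  Convex g = ∀ {E v} → NonBacktracking E g → v ∈ E 0 → v ∈ E g → ∀ k → k ≤ g → v ∈ E k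

  convex-between : ∀ i {j k E v} → (∀ d → d ≤ k → Convex d) → NonBacktracking E k →
    i ≤ j → j ≤ k → v ∈ E i → v ∈ E k → v ∈ E j
  convex-between zero {j} {k} conv W _ j≤k vi vk = conv k ≤-refl W vi vk j j≤k
  convex-between (suc i) {suc j} {suc k} conv W i≤j j≤k vi vk =
    convex-between i (λ d d≤k → conv d (≤-trans d≤k (n≤1+n k))) (nb-tail W)
      (s≤s⁻¹ i≤j) (s≤s⁻¹ j≤k) vi vk

  -- If `E i ≡ E j`, convexity puts every vertex of `E i` into the adjacent facet `E (suc i)`.
  nb-simple : ∀ {i j E} → (∀ d → d ≤ j → Convex d) → NonBacktracking E j → i < j → E i ≢ E j
  nb-simple {i} {j} {E} conv W i<j eq =
    proj₁ (proj₂ (proj₂ (adj W i i<j)))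
      (simplex-≡ (facets W i (<⇒≤ i<j)) (facets W (suc i) i<j)
        (λ v∈ → convex-between i conv W (n≤1+n i) i<j v∈ (subst (_ ∈_) eq v∈)))

  -- After the first step, the turn supplies a vertex missing from the preceding facet; had it
  -- occurred earlier, convexity would put it there too.
  fresh : (∀ d → d < g → Convex d) → NonBacktracking E g → ∀ k → k < g →
    ∃[ w ] (w ∈ E k × w ∈ E (suc k) × (∀ j → j < k → w ∉ E j))
  fresh {E = E} _ W zero k<g with (_ , _ , _ , (_ , ∣∩∣)) ← adj W zero k<g
    with w , w∈ ← ∣∣≡suc⇒Nonempty ∣∩∣ =
    w , p∩q⊆p (E 0) (E 1) w∈ , p∩q⊆q (E 0) (E 1) w∈ , λ _ ()
  fresh conv W (suc k) k<g with w , w∈ , w∉ , w∈' ← turn W k k<g =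
    w , w∈ , w∈' , λ j j<k w∈j →
      w∉ (convex-between j (λ d d≤k → conv d (≤-<-trans d≤k k<g)) (nb-init (<⇒≤ k<g) W)
           (s≤s⁻¹ j<k) (n≤1+n k) w∈j w∈)

  -- The m-simplices at positions 1, …, g are separated by fresh vertices of the facets.
  module Thread {m g E a b} (m≤N : m ≤ N) (W : NonBacktracking E g)
    (conv : ∀ d → d < g → Convex d) (sa : IsSimplex K m a) (sb : IsSimplex K m b)
    (a⊆ : a ⊆ E 0) (b⊆ : b ⊆ E g)
    (a⊈ : ∀ k → k < g → a ⊆ E k → ¬ a ⊆ E (suc k))
    (b⊈ : ∀ k → k < g → b ⊆ E k → ¬ b ⊆ E (suc k))
    (a≢b : g ≡ 0 → a ≢ b) where

    Link : ℕ → Subset V → Set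
    Link k t = IsSimplex K m t × t ⊆ E k × t ⊆ E (suc k) ×
      ∃[ w ] (w ∈ t × (∀ j → j < k → w ∉ E j))

    link : ∀ k → k < g → ∃ (Link k)
    link k k<g
      with (fX , _ , _ , (_ , ∣∩∣)) ← adj W k k<g
         | w , w∈ , w∈' , new ← fresh conv W k k<g
      with t , w∈t , t⊆ , ∣t∣ ← ⊆-interpolate ⁅ w ⁆ (E k ∩ E (suc k)) (suc m)
             (x∈p⇒⁅x⁆⊆p (x∈p∩q⁺ (w∈ , w∈'))) (subst (_≤ suc m) (sym (∣⁅x⁆∣≡1 w)) (s≤s z≤n))
             (subst (suc m ≤_) (sym ∣∩∣) (s≤s m≤N))
      = t , face-of fX t⊆k ∣t∣ , t⊆k , p∩q⊆q (E k) _ ∘ t⊆ , w , w∈t (x∈⁅x⁆ w) , new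
      where
      t⊆k : t ⊆ E k
      t⊆k = p∩q⊆p _ (E (suc k)) ∘ t⊆

    links : Σ (ℕ → Subset V) λ f → f g ≡ b × (∀ k → k < g → Link k (f k))
    links = finiteChoice {P = Link} b g link

    f : ℕ → Subset V
    f = proj₁ links

    fg≡b : f g ≡ b
    fg≡b = proj₁ (proj₂ links)

    f-link : ∀ k → k < g → Link k (f k)
    f-link = proj₂ (proj₂ links)

    path : Seq K
    path = mkSeq (suc g) (a ◁ f) E

    simplices : ∀ k → k ≤ suc g → IsSimplex K m ((a ◁ f) k)
    simplices zero _ = sa
    simplices (suc k) k≤g with m≤n⇒m<n∨m≡n (s≤s⁻¹ k≤g)
    ... | inj₁ k<g = proj₁ (f-link k k<g)
    ... | inj₂ refl = subst (IsSimplex K m) (sym fg≡b) sb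

    left⊆ : ∀ k → k < suc g → (a ◁ f) k ⊆ E k
    left⊆ zero _ = a⊆
    left⊆ (suc k) k<g = proj₁ (proj₂ (proj₂ (f-link k (s<s⁻¹ k<g))))

    right⊆ : ∀ k → k < suc g → f k ⊆ E k
    right⊆ k k<g with m≤n⇒m<n∨m≡n (s≤s⁻¹ k<g)
    ... | inj₁ k<g' = proj₁ (proj₂ (f-link k k<g'))
    ... | inj₂ refl = subst (_⊆ E g) (sym fg≡b) b⊆

    f≢b : ∀ k → k < g → f k ≢ b
    f≢b k k<g eq with _ , ⊆k , ⊆k' , _ ← f-link k k<g =
      b⊈ k k<g (subst (_⊆ E k) eq ⊆k) (subst (_⊆ E (suc k)) eq ⊆k')

    -- A later link has a vertex outside `E i`, and it lies in two consecutive facets, unlike `a`.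
    -- The last position `suc g` is left out, so that `a` and `b` may coincide.
    distinct : ∀ {i j} → i < j → j < suc g → (a ◁ f) i ≢ (a ◁ f) j
    distinct {zero} {suc j} _ j<g eq with _ , ⊆j , ⊆j' , _ ← f-link j (s<s⁻¹ j<g) =
      a⊈ j (s<s⁻¹ j<g) (subst (_⊆ E j) (sym eq) ⊆j) (subst (_⊆ E (suc j)) (sym eq) ⊆j')
    distinct {suc i} {suc j} i<j j<g eq with _ , _ , _ , w , w∈ , new ← f-link j (s<s⁻¹ j<g) =
      new i (s<s⁻¹ i<j) (right⊆ i (<-trans (<⇒≤ i<j) j<g) (subst (w ∈_) (sym eq) w∈))

    step≢ : ∀ k → k < suc g → (a ◁ f) k ≢ f k
    step≢ k k<g with m≤n⇒m<n∨m≡n (s≤s⁻¹ k<g)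
    ... | inj₁ k<g' = distinct (n<1+n k) (s<s k<g')
    step≢ zero _ | inj₂ refl = λ eq → a≢b refl (trans eq fg≡b)
    step≢ (suc k) _ | inj₂ refl = λ eq → f≢b k (n<1+n k) (trans eq fg≡b)

    walk : IsWalk K m (suc N) a b path
    walk = refl , fg≡b , simplices ,
      λ k k<g → facets W k (s≤s⁻¹ k<g) , step≢ k k<g , left⊆ k k<g , right⊆ k k<g

    ridges : ℕ → Subset V
    -- `CondII` reads indices from 1 on; `⊥` is a filler.
    ridges = ⊥ ◁ λ k → E k ∩ E (suc k)

    ridges-distinct : ∀ {i j} → i < j → j < g → ridges (suc i) ≢ ridges (suc j)
    ridges-distinct {i} {j} i<j j<g eq with w , w∈ , w∈' , new ← fresh conv W j j<g =
      new i i<j (p∩q⊆p (E i) _ (subst (w ∈_) (sym eq) (x∈p∩q⁺ (w∈ , w∈'))))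

    condII : CondII K (suc N) path
    condII = ridges ,
      (λ k k<g → proj₂ (proj₂ (proj₂ (adj W k (s<s⁻¹ k<g)))) ,
        p∩q⊆p (E k) _ , p∩q⊆q (E k) _ , ∩-greatest (right⊆ k (<⇒≤ k<g)) (left⊆ (suc k) k<g)) ,
      λ i j i<g j<g → <-distinct⇒injective {f = tail ridges} ridges-distinct i j (s<s⁻¹ i<g) (s<s⁻¹ j<g)

  -- Walks in the absence of vertex cycles.

  module _ (acyclic₀ : ∀ p → ¬ IsSimplicialCycle K 0 (suc N) p) where

    -- A shortest non-backtracking walk that leaves the star of a vertex v and returns to it
    -- threads a (0, n)-simplicial cycle through v.
    no-return : ∀ e {E v} → (∀ d → d < suc e → Convex d) → NonBacktracking E (suc e) →
      v ∈ E 0 → v ∉ E 1 → v ∉ E (suc e)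
    no-return zero _ _ _ v∉E₁ = v∉E₁
    no-return (suc e) {E} {v} conv W v∈E₀ v∉E₁ v∈E = acyclic₀ path
      ((walk , λ i j i<r j<r i≢j →
          i≢j ∘ <-distinct⇒injective distinct i j i<r j<r ,
          i≢j ∘ <-distinct⇒injective facets-distinct i j i<r j<r) ,
       s≤s (s≤s (s≤s z≤n)) ,
       (λ k 1≤k k<d ⊆k → v∉ k 1≤k (s<s⁻¹ k<d) (⊆k (x∈⁅x⁆ v))) ,
       condII)
      where
      d : ℕ
      d = suc (suc e)

      v∉ : ∀ k → 0 < k → k < d → v ∉ E k
      v∉ k 0<k k<d v∈k = v∉E₁ (conv k k<d (nb-init (<⇒≤ k<d) W) v∈E₀ v∈k 1 0<k)

      never-twice : ∀ k → k < d → ⁅ v ⁆ ⊆ E k → ¬ ⁅ v ⁆ ⊆ E (suc k)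
      never-twice zero _ _ ⊆₁ = v∉E₁ (⊆₁ (x∈⁅x⁆ v))
      never-twice (suc k) k<d ⊆k _ = v∉ (suc k) z<s k<d (⊆k (x∈⁅x⁆ v))

      -- Both ends are `⁅ v ⁆`; they would have to differ only on a walk of length 0.
      open Thread {a = ⁅ v ⁆} {⁅ v ⁆} z≤n W conv (vertex-simplex v) (vertex-simplex v)
        (x∈p⇒⁅x⁆⊆p v∈E₀) (x∈p⇒⁅x⁆⊆p v∈E) never-twice never-twice (λ ())

      -- `nb-simple` would require convexity at length `d` itself. Instead, if `E 0 ≡ E d`, the
      -- vertices of `E 1` in `E 0` reach `E 2` by convexity of the tail, and the one outside `E 0`
      -- by the turn, so `E 1 ≡ E 2`.
      start≢end : E 0 ≢ E d
      start≢end eq = proj₁ (proj₂ (proj₂ (adj W 1 (s<s z<s))))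
        (simplex-≡ (facets W 1 (s≤s z≤n)) (facets W 2 (s≤s (s≤s z≤n))) E₁⊆E₂)
        where
        E₁⊆E₂ : E 1 ⊆ E 2
        E₁⊆E₂ {x} x∈ with x ∈? E 0
        ... | yes x∈E₀ = conv (suc e) (n<1+n _) (nb-tail W) x∈ (subst (x ∈_) eq x∈E₀) 1 (s≤s z≤n)
        ... | no x∉E₀ with w , w∈ , w∉ , w∈E₂ ← turn W 0 (s<s z<s) =
          subst (_∈ E 2) (Adj-new-unique (adj W 0 z<s) w∈ w∉ x∈ x∉E₀) w∈E₂

      facets-distinct : ∀ {i j} → i < j → j < suc d → E i ≢ E j
      facets-distinct {i} {j} i<j j<d eq with m≤n⇒m<n∨m≡n (s≤s⁻¹ j<d)
      ... | inj₁ j<d' = nb-simple (λ _ d≤j → conv _ (≤-<-trans d≤j j<d'))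
                          (nb-init (<⇒≤ j<d') W) i<j eq
      facets-distinct {zero} _ _ eq | inj₂ refl = start≢end eq
      facets-distinct {suc i} i<j _ eq | inj₂ refl =
        v∉ (suc i) z<s i<j (subst (v ∈_) (sym eq) v∈E)

    convex : ∀ g → Convex g
    convex = <-rec Convex step
      where
      step : ∀ g → (∀ {d} → d < g → Convex d) → Convex g
      step g conv W v∈E₀ v∈E zero _ = v∈E₀
      step (suc g) conv {E} {v} W v∈E₀ v∈E (suc k) k≤g with v ∈? E 1
      ... | yes v∈E₁ = conv (n<1+n g) (nb-tail W) v∈E₁ v∈E k (s≤s⁻¹ k≤g)
      ... | no v∉E₁ = contradiction v∈E (no-return g (λ _ → conv) W v∈E₀ v∉E₁)

    -- `E` run backwards and then `F` form a walk between facets containing `b`, with `F 0` at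
    -- position `r`.
    fork : NonBacktracking E r → NonBacktracking F s → E 0 ≡ F 0 →
      (0 < r → 0 < s → Turn (E 1) (E 0) (F 1)) → b ⊆ E r → b ⊆ F s → b ⊆ F 0
    fork {E} {r} {F} {s} WE WF eq t b⊆E b⊆F {v} v∈b =
      subst (v ∈_) (trans (cong (glue r E F) (sym (+-identityʳ r))) (glue-last r E F 0))
        (convex (r + s) (nb-glue r WE WF eq t)
          (subst (v ∈_) (sym (glue-first r E F eq)) (b⊆E v∈b))
          (subst (v ∈_) (sym (glue-last r E F s)) (b⊆F v∈b)) r (m≤m+n r s))

    fork-adj : NonBacktracking E r → NonBacktracking F s → Adj (E 0) (F 0) →
      (0 < r → Turn (E 1) (E 0) (F 0)) → (0 < s → Turn (E 0) (F 0) (F 1)) →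
      b ⊆ E r → b ⊆ F s → b ⊆ E 0 × b ⊆ F 0
    fork-adj {E} {F = F} {s} {b} WE WF EF tE tF b⊆E b⊆F = b⊆E₀ , λ v∈b →
      convex (suc s) W (b⊆E₀ v∈b) (b⊆F v∈b) 1 (s≤s z≤n)
      where
      W : NonBacktracking (E 0 ◁ F) (suc s)
      W = nb-cons EF tF WF
      b⊆E₀ : b ⊆ E 0
      b⊆E₀ = fork WE W refl (λ 0<r _ → tE 0<r) b⊆E b⊆F

    -- Where the first ridges differ, `fork` puts `b` into the common start. If they agree but
    -- `E 1 ≢ F 1`, these facets are adjacent across that ridge, and `fork-adj` puts `b` into
    -- `E 1 ∩ F 1 ⊆ E 0`. Both are excluded, so the first steps agree.
    same-walk : ∀ r s {E F} → NonBacktracking E r → NonBacktracking F s → E 0 ≡ F 0 →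
      b ⊆ E r → b ⊆ F s → (∀ k → k < r → ¬ b ⊆ E k) → (∀ k → k < s → ¬ b ⊆ F k) →
      r ≡ s × (∀ k → k ≤ r → E k ≡ F k)
    same-walk zero zero _ _ eq _ _ _ _ = refl , λ { zero _ → eq }
    same-walk {b} zero (suc s) _ _ eq b⊆E _ _ b⊈F =
      contradiction (λ {v} → subst (b ⊆_) eq b⊆E {v}) (b⊈F 0 z<s)
    same-walk {b} (suc r) zero _ _ eq _ b⊆F b⊈E _ =
      contradiction (λ {v} → subst (b ⊆_) (sym eq) b⊆F {v}) (b⊈E 0 z<s)
    same-walk {b} (suc r) (suc s) {E} {F} WE WF eq b⊆E b⊆F b⊈E b⊈F = compare
      where
      EF : Adj (E 0) (F 1)
      EF = subst (λ x → Adj x (F 1)) (sym eq) (adj WF 0 z<s)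

      compare : suc r ≡ suc s × (∀ k → k ≤ suc r → E k ≡ F k)
      compare with Turn? (Adj-sym (adj WE 0 z<s)) EF
      ... | inj₁ t = contradiction (λ {v} → fork WE WF eq (λ _ _ → t) b⊆E b⊆F {v}) (b⊈F 0 z<s)
      ... | inj₂ (E₁∩E₀⊆F₁ , E₀∩F₁⊆E₁) with E 1 ≟ˢ F 1
      ...   | yes eq₁ with r≡s , E≡F ← same-walk r s (nb-tail WE) (nb-tail WF) eq₁ b⊆E b⊆F
                        (λ k k<r → b⊈E (suc k) (s<s k<r)) (λ k k<s → b⊈F (suc k) (s<s k<s))
        = cong suc r≡s , λ { zero _ → eq ; (suc k) k≤r → E≡F k (s≤s⁻¹ k≤r) }
      ...   | no E₁≢F₁ = contradiction (λ {v} → b⊆E₀ {v}) (b⊈E 0 z<s)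
        where
        ridge : Ridge (E 1 ∩ E 0)
        ridge = proj₂ (proj₂ (proj₂ (Adj-sym (adj WE 0 z<s))))
        fE₁ : Facet (E 1)
        fE₁ = facets WE 1 (s≤s z≤n)
        fF₁ : Facet (F 1)
        fF₁ = facets WF 1 (s≤s z≤n)
        E₁∩F₁⊆E₀ : E 1 ∩ F 1 ⊆ E 0
        E₁∩F₁⊆E₀ = p∩q⊆q (E 1) (E 0) ∘ subst (_ ∈_)
          (sym (ridge⇒≡∩ fE₁ fF₁ E₁≢F₁ ridge (p∩q⊆p (E 1) (E 0)) E₁∩E₀⊆F₁))
        tE : 0 < r → Turn (E 2) (E 1) (F 1)
        tE 0<r with w , w∈ , w∉ , w∈E₀ ← Turn-sym (adj WE 0 z<s) (adj WE 1 (s<s 0<r)) (turn WE 0 (s<s 0<r))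
          = w , w∈ , w∉ , E₁∩E₀⊆F₁ (x∈p∩q⁺ (w∈ , w∈E₀))
        tF : 0 < s → Turn (F 2) (F 1) (E 1)
        tF 0<s with w , w∈ , w∉ , w∈F₀ ← Turn-sym (adj WF 0 z<s) (adj WF 1 (s<s 0<s)) (turn WF 0 (s<s 0<s))
          = w , w∈ , w∉ , E₀∩F₁⊆E₁ (x∈p∩q⁺ (subst (w ∈_) (sym eq) w∈F₀ , w∈))
        E₁F₁ : Adj (E 1) (F 1)
        E₁F₁ = ridge⇒Adj fE₁ fF₁ E₁≢F₁ ridge (p∩q⊆p (E 1) (E 0)) E₁∩E₀⊆F₁
        b⊆E₁×b⊆F₁ : b ⊆ E 1 × b ⊆ F 1
        b⊆E₁×b⊆F₁ = fork-adj (nb-tail WE) (nb-tail WF) E₁F₁ tE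
          (λ 0<s → Turn-sym (Adj-sym (adj WF 1 (s<s 0<s))) (Adj-sym E₁F₁) (tF 0<s)) b⊆E b⊆F
        b⊆E₀ : b ⊆ E 0
        b⊆E₀ v∈b = E₁∩F₁⊆E₀ (x∈p∩q⁺ (proj₁ b⊆E₁×b⊆F₁ v∈b , proj₂ b⊆E₁×b⊆F₁ v∈b))

  -- Joining facets by non-backtracking walks

  Reach : Subset V → Subset V → Set
  Reach X Y = Σ (ℕ → Subset V) λ E → ∃[ g ] (NonBacktracking E g × E 0 ≡ X × E g ≡ Y)

  -- Without a turn at `Y`, the facets `X`, `Y` and `E 1` share one ridge, so `Y` is skipped: `X` is
  -- `E 1`, or adjacent to it across the old ridge, which preserves the next turn.
  reach-step : Facet X → Ridge z → z ⊆ X → z ⊆ Y → Facet Y → Reach Y Z → Reach X Z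
  reach-step {X} {Y = Y} fX rz z⊆X z⊆Y fY reachY with X ≟ˢ Y
  ... | yes refl = reachY
  reach-step {X} fX rz z⊆X z⊆Y fY (E , zero , W , refl , eq) | no X≢Y =
    X ◁ E , 1 , nb-cons (ridge⇒Adj fX fY X≢Y rz z⊆X z⊆Y) (λ ()) W , refl , eq
  reach-step {X} fX rz z⊆X z⊆Y fY (E , suc g , W , refl , eq) | no X≢Y
    with ridge⇒Adj fX fY X≢Y rz z⊆X z⊆Y
  ... | XE₀ with Turn? XE₀ (adj W 0 z<s)
  ...   | inj₁ t = X ◁ E , suc (suc g) , nb-cons XE₀ (λ _ → t) W , refl , eq
  ...   | inj₂ (X∩E₀⊆E₁ , E₀∩E₁⊆X) with X ≟ˢ E 1
  ...     | yes refl = tail E , g , nb-tail W , refl , eq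
  ...     | no X≢E₁ = X ◁ tail E , suc g , nb-cons XE₁ t (nb-tail W) , refl , eq
    where
    XE₁ : Adj X (E 1)
    XE₁ = ridge⇒Adj fX (facets W 1 (s≤s z≤n)) X≢E₁ (proj₂ (proj₂ (proj₂ XE₀)))
            (p∩q⊆p X (E 0)) X∩E₀⊆E₁
    t : 0 < g → Turn X (E 1) (E 2)
    t 0<g with w , w∈ , w∉ , w∈E₀ ← Turn-sym (adj W 0 z<s) (adj W 1 (s<s 0<g)) (turn W 0 (s<s 0<g))
      = Turn-sym (Adj-sym (adj W 1 (s<s 0<g))) (Adj-sym XE₁)
          (w , w∈ , w∉ , E₀∩E₁⊆X (x∈p∩q⁺ (w∈E₀ , w∈)))

  -- `reach-step` prepends facets, so the result runs against the given walk, from its end `b` to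
  -- its start `a`.
  walk⇒reach : ∀ {l sig eta} → IsWalk K N (suc N) a b (mkSeq (suc l) sig eta) →
    Facet X → Facet Y → b ⊆ X → a ⊆ Y → Reach X Y
  walk⇒reach {X = X} {Y} {l} {sig} {eta} (refl , refl , simp , steps) fX fY b⊆X a⊆Y
    with fE , _ , _ , r⊆ ← steps l ≤-refl =
    reach-step fX (simp (suc l) ≤-refl) b⊆X r⊆ fE (reaches l ≤-refl)
    where
    reaches : ∀ k → k < suc l → Reach (eta k) Y
    reaches zero k<l with fE , _ , l⊆ , _ ← steps 0 k<l =
      reach-step fE (simp 0 z≤n) l⊆ a⊆Y fY ((λ _ → Y) , 0 , nb-const fY , refl , refl)
    reaches (suc k) k<l with fE , _ , l⊆ , _ ← steps (suc k) k<l
      with fE' , _ , _ , r⊆ ← steps k (<⇒≤ k<l) =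
      reach-step fE (simp (suc k) (<⇒≤ k<l)) l⊆ r⊆ fE' (reaches k (<⇒≤ k<l))

  connected⇒reach : Connected K (suc N) → Facet X → Facet Y → Reach X Y
  connected⇒reach {X} {Y} conn fX fY with X ≟ˢ Y
  ... | yes refl = (λ _ → X) , 0 , nb-const fX , refl , refl
  ... | no X≢Y
    -- `Connected` joins distinct ridges; taking `y` through a vertex `c` outside `X` makes it
    -- differ from `x`.
    with c , c∈Y , c∉X ← ⊈⇒∃ (λ Y⊆X → X≢Y (sym (simplex-≡ fY fX Y⊆X)))
    with y , c∈y , y⊆Y , ∣y∣ ← ⊆-interpolate ⁅ c ⁆ Y (suc N) (x∈p⇒⁅x⁆⊆p c∈Y)
           (subst (_≤ suc N) (sym (∣⁅x⁆∣≡1 c)) (s≤s z≤n)) (subst (suc N ≤_) (sym (proj₂ fY)) (n≤1+n _))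
       | x , _ , x⊆X , ∣x∣ ← ⊆-interpolate ⊥ X (suc N) ⊥⊆
           (subst (_≤ suc N) (sym (∣⊥∣≡0 V)) z≤n) (subst (suc N ≤_) (sym (proj₂ fX)) (n≤1+n _))
    with conn y x (face-of fY y⊆Y ∣y∣) (face-of fX x⊆X ∣x∣)
           (λ y≡x → c∉X (x⊆X (subst (c ∈_) y≡x (c∈y (x∈⁅x⁆ c)))))
  ... | mkSeq zero _ _ , (sig₀≡y , sig₀≡x , _) , _ = contradiction
          (x⊆X (subst (c ∈_) (trans (sym sig₀≡y) sig₀≡x) (c∈y (x∈⁅x⁆ c)))) c∉X
  ... | mkSeq (suc l) _ _ , walk , _ = walk⇒reach walk fX fY x⊆X y⊆Y

  -- Reduced path sequences

  -- `X ∩ Y` is a joint ridge: this is the case excluded in `Cond2`.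
  InAdjacent : Subset V → Subset V → Set
  InAdjacent a b = ∃[ X ] ∃[ Y ] (Adj X Y × a ⊆ X ∩ Y × b ⊆ X ∩ Y)

  ⊈⇒Turn : a ⊆ Y → a ⊆ Z → ¬ a ⊆ X → Turn X Y Z
  ⊈⇒Turn a⊆Y a⊆Z a⊈X with v , v∈a , v∉X ← ⊈⇒∃ a⊈X = v , a⊆Y v∈a , v∉X , a⊆Z v∈a

  -- Without a turn, two consecutive ridges of condition (ii) would lie in the same two facets and
  -- so be equal.
  condII⇒nb : ∀ {sig} → (∀ k → k < suc g → Facet (E k)) →
    (∀ i j → i < suc g → j < suc g → E i ≡ E j → i ≡ j) →
    CondII K (suc N) (mkSeq (suc g) sig E) → NonBacktracking E g
  condII⇒nb {g} {E} fE E-inj (ρ , ridges , ρ-inj) =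
    nb (λ k k≤g → fE k (s≤s k≤g)) adjacent turns
    where
    adjacent : ∀ k → k < g → Adj (E k) (E (suc k))
    adjacent k k<g with rz , z⊆ , z⊆' , _ ← ridges k (s<s k<g) =
      ridge⇒Adj (fE k (<⇒≤ (s<s k<g))) (fE (suc k) (s<s k<g))
        (λ eq → 1+n≢n (sym (E-inj k (suc k) (<⇒≤ (s<s k<g)) (s<s k<g) eq))) rz z⊆ z⊆'

    turns : ∀ k → suc k < g → Turn (E k) (E (suc k)) (E (2 + k))
    turns k k<g with Turn? (adjacent k (<⇒≤ k<g)) (adjacent (suc k) k<g)
    ... | inj₁ t = t
    ... | inj₂ (⊆E , _)
      with (fX , fY , X≢Y , _) ← adjacent k (<⇒≤ k<g)
         | (_ , fZ , Y≢Z , _) ← adjacent (suc k) k<g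
         | rz , z⊆ , z⊆' , _ ← ridges k (s<s (<⇒≤ k<g))
         | rz' , z'⊆ , z'⊆' , _ ← ridges (suc k) (s<s k<g) =
      contradiction
        (ρ-inj k (suc k) (s<s (<⇒≤ k<g)) (s<s k<g)
          (ridge-unique fY fZ Y≢Z rz z⊆' (⊆E ∘ ∩-greatest z⊆ z⊆') rz' z'⊆ z'⊆'))
        (λ k≡1+k → 1+n≢n (sym k≡1+k))

  reduced⇒nb : ∀ {m g sig E} → IsReduced K m (suc N) a b (mkSeq (suc g) sig E) →
    NonBacktracking E g × a ⊆ E 0 × b ⊆ E g ×
    (∀ k → 0 < k → k ≤ g → ¬ a ⊆ E k) × (∀ k → k < g → ¬ b ⊆ E k)
  reduced⇒nb {g = g} {sig} (((refl , refl , _ , steps) , _ , E-inj) , first , last , condII) =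
    condII⇒nb {sig = sig} (λ k k<g → proj₁ (steps k k<g)) E-inj condII ,
    proj₁ (proj₂ (proj₂ (steps 0 z<s))) , proj₂ (proj₂ (proj₂ (steps g ≤-refl))) ,
    (λ { (suc k) _ k≤g a⊆ → 1+n≢0 (first (suc k) (s≤s k≤g) a⊆) }) ,
    (λ k k<g b⊆ → <-irrefl (suc-injective (last k (<⇒≤ (s<s k<g)) b⊆)) k<g)

  ridges-InAdjacent⇒≡ : Ridge a → Ridge b → InAdjacent a b → a ≡ b
  ridges-InAdjacent⇒≡ ra rb (X , Y , (fX , fY , X≢Y , _) , a⊆ , b⊆) =
    ridge-unique fX fY X≢Y ra (p∩q⊆p X Y ∘ a⊆) (p∩q⊆q X Y ∘ a⊆) rb (p∩q⊆p X Y ∘ b⊆) (p∩q⊆q X Y ∘ b⊆)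

  -- Reduced paths in a tree.

  module _ (conn : Connected K (suc N)) (acyclic₀ : ∀ p → ¬ IsSimplicialCycle K 0 (suc N) p) where

    -- If E 0 ≠ F 0, joining them inside the star of a gives one walk from E r to F s through
    -- all three pieces; its ends lie in the star of b, hence so does the part inside the star of a.
    same-start : NonBacktracking E r → NonBacktracking F s → a ⊆ E 0 → a ⊆ F 0 →
      (0 < r → ¬ a ⊆ E 1) → (0 < s → ¬ a ⊆ F 1) → b ⊆ E r → b ⊆ F s → ¬ InAdjacent a b →
      E 0 ≡ F 0
    same-start {E} {r} {F} {s} {a} {b} WE WF a⊆E₀ a⊆F₀ a⊈E₁ a⊈F₁ b⊆E b⊆F ¬adj
      with connected⇒reach conn (facets WE 0 z≤n) (facets WF 0 z≤n)
    ... | G , zero , _ , G₀≡E₀ , G₀≡F₀ = trans (sym G₀≡E₀) G₀≡F₀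
    ... | G , g@(suc g') , WG , G₀≡E₀ , Gg≡F₀ = contradiction meet ¬adj
      where
      -- `glue` runs `G` backwards: `H` goes from `F 0` through the star of `a` to `E 0`, then along
      -- `E`.
      H : ℕ → Subset V
      H = glue g G E
      a⊆G₀ : a ⊆ G 0
      a⊆G₀ = subst (a ⊆_) (sym G₀≡E₀) a⊆E₀
      a⊆Gg : a ⊆ G g
      a⊆Gg = subst (a ⊆_) (sym Gg≡F₀) a⊆F₀
      a⊆G₁ : a ⊆ G 1
      a⊆G₁ v∈a = convex acyclic₀ g WG (a⊆G₀ v∈a) (a⊆Gg v∈a) 1 (s≤s z≤n)
      WH : NonBacktracking H (g + r)
      WH = nb-glue g WG WE G₀≡E₀ λ _ 0<r →
        Turn-sym (subst (Adj (E 1)) (sym G₀≡E₀) (Adj-sym (adj WE 0 0<r))) (adj WG 0 z<s)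
          (⊈⇒Turn a⊆G₀ a⊆G₁ (a⊈E₁ 0<r))
      H₀≡Gg : H 0 ≡ G g
      H₀≡Gg = glue-first g G E G₀≡E₀
      H₀≡F₀ : H 0 ≡ F 0
      H₀≡F₀ = trans H₀≡Gg Gg≡F₀
      Hg≡E₀ : H g ≡ E 0
      Hg≡E₀ = trans (cong H (sym (+-identityʳ g))) (glue-last g G E 0)
      a⊆H₀ : a ⊆ H 0
      a⊆H₀ = subst (a ⊆_) (sym H₀≡Gg) a⊆Gg
      a⊆H₁ : a ⊆ H 1
      a⊆H₁ v∈a = convex acyclic₀ g (nb-init (m≤m+n g r) WH) (a⊆H₀ v∈a)
        (subst (_ ∈_) (sym Hg≡E₀) (a⊆E₀ v∈a)) 1 (s≤s z≤n)
      b⊆H : b ⊆ H (g + r)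
      b⊆H = subst (b ⊆_) (sym (glue-last g G E r)) b⊆E
      b⊆H₀ : b ⊆ H 0
      b⊆H₀ = subst (b ⊆_) (sym H₀≡F₀) (fork acyclic₀ WH WF H₀≡F₀
        (λ _ 0<s → Turn-sym (subst (Adj (F 1)) (sym H₀≡F₀) (Adj-sym (adj WF 0 0<s))) (adj WH 0 z<s)
          (⊈⇒Turn a⊆H₀ a⊆H₁ (a⊈F₁ 0<s))) b⊆H b⊆F)
      b⊆H₁ : b ⊆ H 1
      b⊆H₁ v∈b = convex acyclic₀ (g + r) WH (b⊆H₀ v∈b) (b⊆H v∈b) 1 (s≤s z≤n)
      meet : InAdjacent a b
      meet = H 0 , H 1 , adj WH 0 z<s , ∩-greatest a⊆H₀ a⊆H₁ , ∩-greatest b⊆H₀ b⊆H₁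

    reduced-same-facets : ∀ {m g h sig sig'} →
      IsReduced K m (suc N) a b (mkSeq (suc g) sig E) → IsReduced K m (suc N) a b (mkSeq (suc h) sig' F) →
      ¬ InAdjacent a b → g ≡ h × (∀ k → k ≤ g → E k ≡ F k)
    reduced-same-facets {g = g} {h} rp rq ¬adj
      with WE , a⊆E , b⊆E , a⊈E , b⊈E ← reduced⇒nb rp
         | WF , a⊆F , b⊆F , a⊈F , b⊈F ← reduced⇒nb rq =
      same-walk acyclic₀ g h WE WF
        (same-start WE WF a⊆E a⊆F (a⊈E 1 z<s) (a⊈F 1 z<s) b⊆E b⊆F ¬adj) b⊆E b⊆F b⊈E b⊈F

    -- The inner simplices serve as their own ridges in (ii). If `sig 0` lay in a later facet,
    -- convexity would put it into `E 1`, making it the common ridge `sig 1` of `E 0` and `E 1`; the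
    -- other end is similar.
    path⇒reduced : ∀ {p} → IsPath K N (suc N) a b p → a ≢ b → IsReduced K N (suc N) a b p
    path⇒reduced {p = mkSeq zero _ _} ((refl , refl , _) , _) a≢b = contradiction refl a≢b
    path⇒reduced {p = mkSeq (suc g) sig E} path@((refl , refl , simp , steps) , sig-inj , E-inj) _ =
      path , first , last , condII
      where
      condII : CondII K (suc N) (mkSeq (suc g) sig E)
      condII = sig ,
        (λ k k<g → simp (suc k) (<⇒≤ k<g) , proj₂ (proj₂ (proj₂ (steps k (<⇒≤ k<g)))) ,
          proj₁ (proj₂ (proj₂ (steps (suc k) k<g))) , id) ,
        λ i j i<g j<g eq → suc-injective (sig-inj (suc i) (suc j) (<⇒≤ i<g) (<⇒≤ j<g) eq)
      W : NonBacktracking E g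
      W = condII⇒nb {sig = sig} (λ k k<g → proj₁ (steps k k<g)) E-inj condII

      first : ∀ k → k < suc g → sig 0 ⊆ E k → k ≡ 0
      first zero _ _ = refl
      first (suc k) k<g sig₀⊆
        with _ , sig₀≢sig₁ , l⊆₀ , r⊆₀ ← steps 0 z<s
           | _ , _ , l⊆₁ , _ ← steps 1 (≤-trans (s≤s (s≤s z≤n)) k<g)
           | (fX , fY , X≢Y , _) ← adj W 0 (≤-trans (s≤s z≤n) (s≤s⁻¹ k<g)) =
        contradiction
          (ridge-unique fX fY X≢Y (simp 0 z≤n) l⊆₀
            (λ v∈ → convex acyclic₀ (suc k) (nb-init (s≤s⁻¹ k<g) W) (l⊆₀ v∈) (sig₀⊆ v∈) 1 (s≤s z≤n))
            (simp 1 (s≤s z≤n)) r⊆₀ l⊆₁)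
          sig₀≢sig₁

      last : ∀ k → k < suc g → sig (suc g) ⊆ E k → suc k ≡ suc g
      last k k<g sig⊆ with m≤n⇒m<n∨m≡n (s≤s⁻¹ k<g)
      ... | inj₂ refl = refl
      ... | inj₁ (s≤s {n = h} k≤h)
        with _ , _ , _ , r⊆ ← steps h (<⇒≤ ≤-refl)
           | _ , sig≢ , l⊆' , r⊆' ← steps (suc h) ≤-refl
           | (fX , fY , X≢Y , _) ← adj W h ≤-refl =
        contradiction
          (ridge-unique fX fY X≢Y (simp (suc h) (n≤1+n _)) r⊆ l⊆' (simp (2 + h) ≤-refl)
            (λ v∈ → convex-between k (λ d _ → convex acyclic₀ d) W k≤h (n≤1+n h) (sig⊆ v∈) (r⊆' v∈))
            r⊆')
          sig≢

    -- The facets agree, and each inner ridge is the only one common to its two neighbouring facets.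
    same-seq : ∀ {p q} → IsReduced K N (suc N) a b p → IsReduced K N (suc N) a b q → a ≢ b →
      SameSeq K p q
    same-seq {p = mkSeq zero _ _} (((refl , refl , _) , _) , _) _ a≢b = contradiction refl a≢b
    same-seq {q = mkSeq zero _ _} _ (((refl , refl , _) , _) , _) a≢b = contradiction refl a≢b
    same-seq {a} {b} {p = mkSeq (suc g) sig E} {q = mkSeq (suc h) sig' F}
      rp@(((s₀ , sₗ , simp , steps) , _) , _) rq@(((s₀' , sₗ' , simp' , steps') , _) , _) a≢b
      with refl , E≡F ← reduced-same-facets rp rq
             (a≢b ∘ ridges-InAdjacent⇒≡ (subst Ridge s₀ (simp 0 z≤n)) (subst Ridge sₗ (simp (suc g) ≤-refl)))
      = refl , sigs , λ k k<g → E≡F k (s≤s⁻¹ k<g)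
      where
      sigs : ∀ k → k ≤ suc g → sig k ≡ sig' k
      sigs zero _ = trans s₀ (sym s₀')
      sigs (suc k) k≤g with m≤n⇒m<n∨m≡n k≤g
      ... | inj₂ refl = trans sₗ (sym sₗ')
      ... | inj₁ k<g with (fX , fY , X≢Y , _) ← adj (proj₁ (reduced⇒nb rp)) k (s<s⁻¹ k<g) =
        ridge-unique fX fY X≢Y
          (simp (suc k) k≤g) (proj₂ (proj₂ (proj₂ (steps k k≤g)))) (proj₁ (proj₂ (proj₂ (steps (suc k) k<g))))
          (simp' (suc k) k≤g)
          (subst (sig' (suc k) ⊆_) (sym (E≡F k (s≤s⁻¹ k≤g))) (proj₂ (proj₂ (proj₂ (steps' k k≤g)))))
          (subst (sig' (suc k) ⊆_) (sym (E≡F (suc k) (s≤s⁻¹ k<g))) (proj₁ (proj₂ (proj₂ (steps' (suc k) k<g)))))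

    cond1 : Cond1 K (suc N)
    cond1 a b ra rb a≢b with p , path ← conn a b ra rb a≢b =
      (p , path⇒reduced path a≢b) , λ _ _ rp rq → same-seq rp rq a≢b

    -- Leading facets are dropped while the next one contains `a`; once it does not, convexity keeps
    -- `a` out of all later ones.
    trim-start : ∀ g {E} → NonBacktracking E g → a ⊆ E 0 → b ⊆ E g →
      Σ (ℕ → Subset V) λ E' → ∃[ g' ] (NonBacktracking E' g' × a ⊆ E' 0 × b ⊆ E' g' ×
        (∀ k → 0 < k → k ≤ g' → ¬ a ⊆ E' k))
    trim-start zero {E} W a⊆ b⊆ = E , 0 , W , a⊆ , b⊆ , λ k 0<k k≤0 _ → <-irrefl refl (<-≤-trans 0<k k≤0)
    trim-start {a} (suc g) {E} W a⊆ b⊆ with a ⊆? E 1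
    ... | yes a⊆E₁ = trim-start g (nb-tail W) a⊆E₁ b⊆
    ... | no a⊈E₁ = E , suc g , W , a⊆ , b⊆ , λ k 0<k k≤g a⊆k → a⊈E₁ λ v∈a →
      convex acyclic₀ k (nb-init k≤g W) (a⊆ v∈a) (a⊆k v∈a) 1 0<k

    trim-end : ∀ g {E} → NonBacktracking E g → b ⊆ E g →
      ∃[ h ] (h ≤ g × b ⊆ E h × (∀ k → k < h → ¬ b ⊆ E k))
    trim-end zero _ b⊆ = 0 , z≤n , b⊆ , λ _ ()
    trim-end {b} (suc g) {E} W b⊆ with b ⊆? E g
    ... | yes b⊆g with h , h≤g , rest ← trim-end g (nb-init (n≤1+n g) W) b⊆g =
      h , ≤-trans h≤g (n≤1+n g) , rest
    ... | no b⊈g = suc g , ≤-refl , b⊆ , λ k k<g b⊆k → b⊈g λ v∈b →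
      convex-between k (λ d _ → convex acyclic₀ d) W (s≤s⁻¹ k<g) (n≤1+n g) (b⊆k v∈b) (b⊆ v∈b)

    reduced-exists : ∀ {m} → Pure K (suc N) → m ≤ N → IsSimplex K m a → IsSimplex K m b → a ≢ b →
      ∃[ p ] IsReduced K m (suc N) a b p
    reduced-exists {a} {b} (_ , pure) m≤N sa sb a≢b
      with X , fX , a⊆X ← pure a (proj₁ sa)
         | Y , fY , b⊆Y ← pure b (proj₁ sb)
      with G , g , WG , refl , refl ← connected⇒reach conn fX fY
      with E , h , WE , a⊆E , b⊆E , a⊈E ← trim-start g WG a⊆X b⊆Y
      with r , r≤h , b⊆Er , b⊈E ← trim-end h WE b⊆E
      = path , (walk , sig-inj , E-inj) , first , last , condII
      where
      W : NonBacktracking E r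
      W = nb-init r≤h WE

      open Thread m≤N W (λ d _ → convex acyclic₀ d) sa sb a⊆E b⊆Er
        (λ k k<r _ → a⊈E (suc k) z<s (≤-trans k<r r≤h)) (λ k k<r b⊆k _ → b⊈E k k<r b⊆k) (λ _ → a≢b)

      -- Adds the last position, left out by `distinct`, using `a ≢ b`.
      distinct⁺ : ∀ {i j} → i < j → j < suc (suc r) → (a ◁ f) i ≢ (a ◁ f) j
      distinct⁺ {i} {j} i<j j<r eq with m≤n⇒m<n∨m≡n (s≤s⁻¹ j<r)
      ... | inj₁ j<r' = distinct i<j j<r' eq
      distinct⁺ {zero} _ _ eq | inj₂ refl = a≢b (trans eq fg≡b)
      distinct⁺ {suc i} i<j _ eq | inj₂ refl = f≢b i (s<s⁻¹ i<j) (trans eq fg≡b)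

      sig-inj : ∀ i j → i ≤ suc r → j ≤ suc r → (a ◁ f) i ≡ (a ◁ f) j → i ≡ j
      sig-inj i j i≤r j≤r = <-distinct⇒injective distinct⁺ i j (s≤s i≤r) (s≤s j≤r)

      E-inj : ∀ i j → i < suc r → j < suc r → E i ≡ E j → i ≡ j
      E-inj = <-distinct⇒injective λ i<j j<r →
        nb-simple (λ d _ → convex acyclic₀ d) (nb-init (s≤s⁻¹ j<r) W) i<j

      first : ∀ k → k < suc r → a ⊆ E k → k ≡ 0
      first zero _ _ = refl
      first (suc k) k<r a⊆k = contradiction (λ {v} → a⊆k {v}) (a⊈E (suc k) z<s (≤-trans (s≤s⁻¹ k<r) r≤h))

      last : ∀ k → k < suc r → f r ⊆ E k → suc k ≡ suc r
      last k k<r f⊆ with m≤n⇒m<n∨m≡n (s≤s⁻¹ k<r)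
      ... | inj₂ refl = refl
      ... | inj₁ k<r' = contradiction (λ {v} → subst (_⊆ E k) fg≡b f⊆ {v}) (b⊈E k k<r')

    same-complex : ∀ {m p q} → IsReduced K m (suc N) a b p → IsReduced K m (suc N) a b q → a ≢ b →
      ¬ InAdjacent a b → SamePathComplex K p q
    same-complex {p = mkSeq zero _ _} (((refl , refl , _) , _) , _) _ a≢b _ = contradiction refl a≢b
    same-complex {q = mkSeq zero _ _} _ (((refl , refl , _) , _) , _) a≢b _ = contradiction refl a≢b
    same-complex {p = mkSeq (suc g) _ E} {q = mkSeq (suc h) _ F} rp rq _ ¬adj t
      with refl , E≡F ← reduced-same-facets rp rq ¬adj = mk⇔
        (λ { (ne , k , k<g , t⊆) → ne , k , k<g , subst (t ⊆_) (E≡F k (s≤s⁻¹ k<g)) t⊆ })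
        (λ { (ne , k , k<g , t⊆) → ne , k , k<g , subst (t ⊆_) (sym (E≡F k (s≤s⁻¹ k<g))) t⊆ })

    cond2 : Pure K (suc N) → Cond2 K (suc N)
    cond2 pure m a b m≤ sa sb a≢b ¬joint =
      reduced-exists pure (<⇒≤ (s≤s⁻¹ (subst (_≤ suc N) (+-comm m 2) m≤))) sa sb a≢b ,
      λ p q rp rq → same-complex rp rq a≢b
        λ { (X , Y , (fX , fY , X≢Y , ridge) , a⊆ , b⊆) → ¬joint
              (X ∩ Y , ridge , (X , Y , fX , fY , X≢Y , p∩q⊆p X Y , p∩q⊆q X Y) , a⊆ , b⊆) }

  -- Detours around a cycle

  one-facet-reduced : ∀ {m} → IsSimplex K m a → IsSimplex K m b → a ≢ b → Facet X → a ⊆ X → b ⊆ X →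
    IsReduced K m (suc N) a b (mkSeq 1 (a ◁ λ _ → b) (λ _ → X))
  one-facet-reduced {a} {b} {X} sa sb a≢b fX a⊆X b⊆X =
    ((refl , refl , (λ { zero _ → sa ; (suc _) _ → sb }) ,
      λ { zero _ → fX , a≢b , a⊆X , b⊆X ; (suc _) (s≤s ()) }) ,
      (λ i j i≤1 j≤1 → <-distinct⇒injective distinct i j (s≤s i≤1) (s≤s j≤1)) ,
      λ i j i<1 j<1 _ → trans (n<1⇒n≡0 i<1) (sym (n<1⇒n≡0 j<1))) ,
    (λ k k<1 _ → n<1⇒n≡0 k<1) , (λ k k<1 _ → cong suc (n<1⇒n≡0 k<1)) ,
    -- A single facet leaves no inner position, so `⊥` is a filler.
    (λ _ → ⊥) , (λ { _ (s≤s ()) }) , λ { _ _ (s≤s ()) }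
    where
    distinct : ∀ {i j} → i < j → j < 2 → (a ◁ λ _ → b) i ≢ (a ◁ λ _ → b) j
    distinct {zero} {suc _} _ _ = a≢b
    distinct {suc _} {suc zero} (s≤s ()) _
    distinct {suc _} {suc (suc _)} _ (s≤s (s≤s ()))

  last-index : ∀ {P : ℕ → Set} → (∀ k → Dec (P k)) → ∀ l → P 0 →
    ∃[ k ] (k ≤ l × P k × (∀ j → k < j → j ≤ l → ¬ P j))
  last-index P? zero P₀ = 0 , z≤n , P₀ , λ j 0<j j≤0 _ → <-irrefl refl (<-≤-trans 0<j j≤0)
  last-index {P} P? (suc l) P₀ with P? (suc l)
  ... | yes Pl = suc l , ≤-refl , Pl , λ j l<j j≤l _ → <-irrefl refl (<-≤-trans l<j j≤l)
  ... | no ¬Pl with k , k≤l , Pk , none ← last-index P? l P₀ =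
    k , ≤-trans k≤l (n≤1+n l) , Pk , later
    where
    later : ∀ j → k < j → j ≤ suc l → ¬ P j
    later j k<j j≤l with m≤n⇒m<n∨m≡n j≤l
    ... | inj₁ j<l = none j k<j (s≤s⁻¹ j<l)
    ... | inj₂ refl = ¬Pl

  module _ {k l : ℕ} {sig E : ℕ → Subset V} where

    -- The detour enters `E (suc k)` directly from `sig 1` and follows the cycle to its closing
    -- simplex, which is `sig 0`. Clause (i) holds at the start by the choice of `k`, and at the end
    -- because `sig 0` avoids the inner facets of the cycle.
    cycle-detour : IsSimplicialCycle K N (suc N) (mkSeq (2 + (l + k)) sig E) →
      sig 1 ⊆ E (suc k) → (∀ j → 0 < j → j ≤ l → ¬ sig 1 ⊆ E (suc (j + k))) →
      IsReduced K N (suc N) (sig 1) (sig 0)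
        (mkSeq (suc l) (sig 1 ◁ λ j → sig (2 + (j + k))) (λ j → E (suc (j + k))))
    cycle-detour (((_ , closed , simp , steps) , distinct) , _ , sig₀⊈ , _) sig₁⊆ sig₁⊈ =
      ((refl , closed , simp′ , steps′) , sig′-inj , E′-inj) , first , last , condII
      where
      sig′ : ℕ → Subset V
      sig′ = sig 1 ◁ λ j → sig (2 + (j + k))

      bound : ∀ {j} → j ≤ l → suc (j + k) < 2 + (l + k)
      bound j≤l = s≤s (s≤s (+-monoˡ-≤ k j≤l))

      simp′ : ∀ j → j ≤ suc l → Ridge (sig′ j)
      simp′ zero _ = simp 1 (s≤s z≤n)
      simp′ (suc j) j≤l = simp _ (bound (s≤s⁻¹ j≤l))

      left⊆ : ∀ j → j < suc l → sig′ j ⊆ E (suc (j + k))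
      left⊆ zero _ = sig₁⊆
      left⊆ (suc j) j<l = proj₁ (proj₂ (proj₂ (steps _ (bound (s≤s⁻¹ j<l)))))

      right⊆ : ∀ j → j < suc l → sig′ (suc j) ⊆ E (suc (j + k))
      right⊆ j j<l = proj₂ (proj₂ (proj₂ (steps _ (bound (s≤s⁻¹ j<l)))))

      sig′-distinct : ∀ {i j} → i < j → j < suc (suc l) → sig′ i ≢ sig′ j
      sig′-distinct {i} {suc j} i<j j<l eq with m≤n⇒m<n∨m≡n (s≤s⁻¹ (s≤s⁻¹ j<l))
      sig′-distinct {zero} {suc j} i<j j<l eq | inj₁ j<l' =
        proj₁ (distinct 1 (2 + (j + k)) (s≤s (s≤s z≤n)) (bound j<l') λ ()) eq
      sig′-distinct {suc i} {suc j} i<j j<l eq | inj₁ j<l' =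
        proj₁ (distinct (2 + (i + k)) (2 + (j + k)) (bound (<-trans (s<s⁻¹ i<j) j<l')) (bound j<l')
          (<⇒≢ (s≤s (s≤s (+-monoˡ-< k (s<s⁻¹ i<j)))))) eq
      -- The closing position is outside the range of `distinct`, so index 0 replaces it.
      sig′-distinct {zero} i<j j<l eq | inj₂ refl =
        proj₁ (distinct 1 0 (s≤s (s≤s z≤n)) z<s λ ()) (trans eq closed)
      sig′-distinct {suc i} i<j j<l eq | inj₂ refl =
        proj₁ (distinct (2 + (i + k)) 0 (bound (s<s⁻¹ i<j)) z<s λ ()) (trans eq closed)

      sig′-inj : ∀ i j → i ≤ suc l → j ≤ suc l → sig′ i ≡ sig′ j → i ≡ j
      sig′-inj i j i≤l j≤l = <-distinct⇒injective sig′-distinct i j (s≤s i≤l) (s≤s j≤l)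

      E′-inj : ∀ i j → i < suc l → j < suc l → E (suc (i + k)) ≡ E (suc (j + k)) → i ≡ j
      E′-inj = <-distinct⇒injective λ {i} {j} i<j j<l →
        proj₂ (distinct (suc (i + k)) (suc (j + k)) (bound (s≤s⁻¹ (<-trans i<j j<l))) (bound (s≤s⁻¹ j<l))
          (<⇒≢ (s≤s (+-monoˡ-< k i<j))))

      steps′ : ∀ j → j < suc l → Facet (E (suc (j + k))) × sig′ j ≢ sig′ (suc j) ×
        sig′ j ⊆ E (suc (j + k)) × sig′ (suc j) ⊆ E (suc (j + k))
      steps′ j j<l = proj₁ (steps _ (bound (s≤s⁻¹ j<l))) ,
        sig′-distinct (n<1+n j) (s<s j<l) , left⊆ j j<l , right⊆ j j<l

      first : ∀ j → j < suc l → sig 1 ⊆ E (suc (j + k)) → j ≡ 0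
      first zero _ _ = refl
      first (suc j) j<l ⊆j = contradiction (λ {v} → ⊆j {v}) (sig₁⊈ (suc j) z<s (s≤s⁻¹ j<l))

      last : ∀ j → j < suc l → sig (2 + (l + k)) ⊆ E (suc (j + k)) → suc j ≡ suc l
      last j j<l ⊆j with m≤n⇒m<n∨m≡n (s≤s⁻¹ j<l)
      ... | inj₂ refl = refl
      ... | inj₁ j<l' = contradiction (λ {v} → subst (_⊆ _) closed ⊆j {v})
              (sig₀⊈ (suc (j + k)) (s≤s z≤n) (s≤s (s≤s (+-monoˡ-< k j<l'))))

      condII : CondII K (suc N) (mkSeq (suc l) sig′ (λ j → E (suc (j + k))))
      condII = sig′ ,
        (λ j j<l → simp′ (suc j) (<⇒≤ j<l) , right⊆ j (<⇒≤ j<l) , left⊆ (suc j) j<l , id) ,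
        λ i j i<l j<l eq → suc-injective (sig′-inj (suc i) (suc j) (<⇒≤ i<l) (<⇒≤ j<l) eq)

  -- A cycle offers two reduced paths from sig 1 to sig 0: the facet E 0, and the part of the
  -- cycle after the last facet E (suc k) that contains sig 1.
  no-ridge-cycle : Cond1 K (suc N) → ∀ p → ¬ IsSimplicialCycle K N (suc N) p
  no-ridge-cycle unique (mkSeq (suc (suc c)) sig E)
    cycle@(((_ , _ , simp , steps) , distinct) , s≤s (s≤s 1≤c) , _)
    with k , k≤c , sig₁⊆ , sig₁⊈ ←
           last-index (λ k → sig 1 ⊆? E (suc k)) c (proj₁ (proj₂ (proj₂ (steps 1 (s≤s (s≤s z≤n))))))
    with l , refl ← ∃ (λ l → l + k ≡ c) ∋ (c ∸ k , m∸n+n≡m k≤c)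
    with fE , sig₀≢sig₁ , sig₀⊆ , sig₁⊆₀ ← steps 0 z<s
    with _ , _ , facets≡ ←
           proj₂ (unique (sig 1) (sig 0) (simp 1 (s≤s z≤n)) (simp 0 z≤n) (≢-sym sig₀≢sig₁)) _ _
             (cycle-detour {k} {l} cycle sig₁⊆
               λ j 0<j j≤l → sig₁⊈ (j + k) (+-monoˡ-< k 0<j) (+-monoˡ-≤ k j≤l))
             (one-facet-reduced (simp 1 (s≤s z≤n)) (simp 0 z≤n) (≢-sym sig₀≢sig₁) fE sig₁⊆₀ sig₀⊆)
    -- The first facets of the two paths are `E (suc k)` and `E 0`.
    = proj₂ (distinct (suc k) 0 (s≤s (s≤s k≤c)) z<s λ ()) (facets≡ 0 z<s)

  conds⇒acyclic : Cond1 K (suc N) → Cond3 K (suc N) → Acyclic K (suc N)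
  conds⇒acyclic c1 c3 m p (s≤s m≤N) cycle with m≤n⇒m<n∨m≡n m≤N
  ... | inj₁ m<N = c3 m p (subst (_≤ suc N) (+-comm 2 m) (s≤s m<N)) cycle
  ... | inj₂ refl = no-ridge-cycle c1 p cycle

theorem5p1 : (V n : ℕ) (K : Complex V) → 1 ≤ n → Pure K n → Connected K n →
    SimplicialTree K n ⇔ (Cond1 K n × Cond2 K n × Cond3 K n)
theorem5p1 V (suc N) K _ pure conn = mk⇔
  (λ { (_ , acyclic , _) →
    let acyclic₀ p = acyclic 0 p z<s in
    cond1 conn acyclic₀ , cond2 conn acyclic₀ pure ,
    λ m p m≤ → acyclic m p (≤-trans (≤-trans (n≤1+n (suc m)) (≤-reflexive (+-comm 2 m))) m≤) })
  (λ { (c1 , _ , c3) → conn , conds⇒acyclic c1 c3 , pure })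
  where open Walks N K
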